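{- Let $X=\mathrm{Sp}_{2n}(2)$ with $n\ge2$, and let $\Gamma$ be an $X$-strongly incidence-transitive code in $J(\mathcal{Q}^\epsilon,k)$ for some $k$ with $2\le k\le|\mathcal{Q}^\epsilon|-2$, such that the stabiliser $X_\Delta$ of a codeword $\Delta\in\Gamma$ is irreducible on $V$. Then $X_\Delta$ is not contained in a maximal $\mathcal C_3$-subgroup of $X$.
   Context: $V=\mathbb{F}_2^{2n}$ with symplectic form $B$, $X=\mathrm{Sp}_{2n}(2)$ its isometry group. $\mathcal{Q}^\epsilon$ is the set of quadratic forms $\phi:V\to\mathbb{F}_2$ of type $\epsilon\in\{+,-\}$ with $\phi(x+y)+\phi(x)+\phi(y)=B(x,y)$, $|\mathcal{Q}^\epsilon|=2^{n-1}(2^n+\epsilon)$; $X$ acts by $\phi^g(x)=\phi(xg^{ -1})$. A code in $J(\mathcal{Q}^\epsilon,k)$ is a nonempty set of $k$-subsets of $\mathcal{Q}^\epsilon$; $X$-strongly incidence-transitive means $X$ preserves $\Gamma$, is transitive on it, and each $X_\Delta$ is transitive on $\Delta\times(\mathcal{Q}^\epsilon\setminus\Delta)$. Irreducible: no nonzero proper invariant subspace of $V$. A maximal $\mathcal C_3$-subgroup of $X$: for a prime $b$ with $n=mb$, regard $V$ as the underlying $\mathbb{F}_2$-space of a $2m$-dimensional $\mathbb{F}_{2^b}$-space $W$ with symplectic form $\tilde B$ such that $B=\mathrm{Tr}\circ\tilde B$ (absolute trace); the subgroup is the group of additive bijections $g$ of $W$ for which some $\sigma\in\mathrm{Aut}(\mathbb{F}_{2^b})$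 satisfies $(\alpha w)g=\alpha^\sigma(wg)$ and $\tilde B(ug,vg)=\tilde B(u,v)^\sigma$ (isomorphic to $\mathrm{Sp}_{2m}(2^b)\rtimes C_b$). -}

module Defs where

open import Level using (0ℓ)
open import Data.Bool using (Bool; true; false; _xor_; _∧_; if_then_else_)
open import Data.Nat using (ℕ; zero; suc; _+_; _*_; _∸_; _^_)
open import Data.Nat.Primality using (Prime)
open import Data.Fin using (Fin)
open import Data.Vec using (Vec; []; _∷_; zipWith; replicate; take; drop)
open import Data.List using (List; length)
open import Data.List.Relation.Unary.All using (All)
open import Data.List.Relation.Unary.Any using (Any)
open import Data.List.Relation.Unary.AllPairs using (AllPairs)
open import Data.Product using (Σ; _×_; ∃; ∃-syntax; proj₁; proj₂)
open import Relation.Nullary using (¬_)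
open import Relation.Binary.PropositionalEquality using (_≡_; _≢_)
open import Function.Bundles using (_↔_)
open import Algebra.Structures using (IsCommutativeRing)

-- The symplectic space V = F₂^{2n}, F₂ = Bool (xor = +, ∧ = ·)

V : ℕ → Set
V n = Vec Bool (n + n)

infixl 6 _⊕_
_⊕_ : ∀ {m} → Vec Bool m → Vec Bool m → Vec Bool m
_⊕_ = zipWith _xor_

𝟎 : ∀ {m} → Vec Bool m
𝟎 = replicate _ false

dot : ∀ {m} → Vec Bool m → Vec Bool m → Bool
dot [] [] = false
dot (a ∷ u) (b ∷ v) = (a ∧ b) xor dot u v

-- standard symplectic form w.r.t. a basis e₁..eₙ,f₁..fₙ:
-- B((x,x'),(y,y')) = x·y' + x'·y
B : ∀ n → V n → V n → Bool
B n x y = dot (take n x) (drop n y) xor dot (drop n x) (take n y)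

-- X = Sp_{2n}(2): additive (hence F₂-linear) bijections preserving B

record Sp (n : ℕ) : Set where
  field
    f    : V n → V n
    finv : V n → V n
    linv : ∀ v → finv (f v) ≡ v
    rinv : ∀ v → f (finv v) ≡ v
    add  : ∀ u v → f (u ⊕ v) ≡ f u ⊕ f v
    presB : ∀ u v → B n (f u) (f v) ≡ B n u v
open Sp public

data Sign : Set where
  plus minus : Sign

comb : ∀ {l m} → Vec Bool m → Vec (Vec Bool l) m → Vec Bool l
comb [] [] = 𝟎
comb (c ∷ cs) (v ∷ vs) = (if c then v else 𝟎) ⊕ comb cs vs

HasMaxTotSingular : ∀ n → (V n → Bool) → Set
HasMaxTotSingular n φ =
  Σ (Vec (V n) n) λ vs →
    (∀ c → comb c vs ≡ 𝟎 → c ≡ replicate n false) ×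
    (∀ c → φ (comb c vs) ≡ false)

-- type + : Witt index n (hyperbolic); type − : otherwise (elliptic)
HasType : ∀ n → Sign → (V n → Bool) → Set
HasType n plus  φ = HasMaxTotSingular n φ
HasType n minus φ = ¬ HasMaxTotSingular n φ

record QForm (n : ℕ) (ε : Sign) : Set where
  field
    q     : V n → Bool
    polar : ∀ x y → (q (x ⊕ y) xor q x) xor q y ≡ B n x y
    type  : HasType n ε q
open QForm public

_≈Q_ : ∀ {n ε} → QForm n ε → QForm n ε → Set
φ ≈Q ψ = ∀ x → q φ x ≡ q ψ x

sizeQ : ℕ → Sign → ℕ
sizeQ n plus  = 2 ^ (n ∸ 1) * (2 ^ n + 1)
sizeQ n minus = 2 ^ (n ∸ 1) * (2 ^ n ∸ 1)

Img : ∀ {n ε} → Sp n → QForm n ε → QForm n ε → Set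
Img g φ ψ = ∀ x → q ψ x ≡ q φ (finv g x)

record Subset (n : ℕ) (ε : Sign) : Set where
  field
    mem  : QForm n ε → Bool
    resp : ∀ φ ψ → φ ≈Q ψ → mem φ ≡ mem ψ
open Subset public

HasSize : ∀ {n ε} → Subset n ε → ℕ → Set
HasSize {n} {ε} Δ k =
  Σ (List (QForm n ε)) λ L →
    length L ≡ k ×
    AllPairs (λ φ ψ → ¬ (φ ≈Q ψ)) L ×
    All (λ φ → mem Δ φ ≡ true) L ×
    (∀ φ → mem Δ φ ≡ true → Any (λ ψ → φ ≈Q ψ) L)

MapsTo : ∀ {n ε} → Sp n → Subset n ε → Subset n ε → Set
MapsTo {n} {ε} g Δ Δ' = ∀ (φ ψ : QForm n ε) → Img g φ ψ → mem Δ φ ≡ mem Δ' ψ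

Stab : ∀ {n ε} → Subset n ε → Sp n → Set
Stab Δ g = MapsTo g Δ Δ

Code : ℕ → Sign → Set₁
Code n ε = Subset n ε → Set

StronglyIncTrans : ∀ {n ε} → Code n ε → ℕ → Set
StronglyIncTrans {n} {ε} Γ k =
  (∃[ Δ ] Γ Δ) ×
  (∀ Δ → Γ Δ → HasSize Δ k) ×
  (∀ (g : Sp n) Δ Δ' → Γ Δ → MapsTo g Δ Δ' → Γ Δ') ×
  (∀ Δ Δ' → Γ Δ → Γ Δ' → Σ (Sp n) λ g → MapsTo g Δ Δ') ×
  (∀ Δ → Γ Δ → ∀ (α α' β β' : QForm n ε) →
     mem Δ α ≡ true → mem Δ α' ≡ true →
     mem Δ β ≡ false → mem Δ β' ≡ false →
     Σ (Sp n) λ g → Stab Δ g × Img g α α' × Img g β β')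

IsSubspace : ∀ {l} → (Vec Bool l → Bool) → Set
IsSubspace W = W 𝟎 ≡ true × (∀ u v → W u ≡ true → W v ≡ true → W (u ⊕ v) ≡ true)

Irreducible : ∀ {n} → (Sp n → Set) → Set
Irreducible {n} H =
  ¬ (Σ (V n → Bool) λ W →
       IsSubspace W ×
       (∃[ v ] (W v ≡ true × v ≢ 𝟎)) ×
       (∃[ v ] W v ≡ false) ×
       (∀ g → H g → ∀ v → W v ≡ true → W (f g v) ≡ true))

record FiniteField (b : ℕ) : Set₁ where
  infixl 6 _+ᴷ_
  infixl 7 _*ᴷ_
  field
    K     : Set
    _+ᴷ_  : K → K → K
    _*ᴷ_  : K → K → K
    -ᴷ_   : K → K
    0ᴷ 1ᴷ : K
    isCommRing : IsCommutativeRing _≡_ _+ᴷ_ _*ᴷ_ -ᴷ_ 0ᴷ 1ᴷ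
    0≢1   : 0ᴷ ≢ 1ᴷ
    inverse : ∀ x → x ≢ 0ᴷ → Σ K λ y → x *ᴷ y ≡ 1ᴷ
    card  : K ↔ Fin (2 ^ b)
open FiniteField public

module _ {b : ℕ} (F : FiniteField b) where
  frob : ℕ → K F → K F
  frob zero a = a
  frob (suc i) a = let c = frob i a in _*ᴷ_ F c c

  trace : K F → K F
  trace a = go b
    where
      go : ℕ → K F
      go zero = 0ᴷ F
      go (suc i) = _+ᴷ_ F (go i) (frob i a)

  emb : Bool → K F
  emb false = 0ᴷ F
  emb true  = 1ᴷ F

  record FieldAut : Set where
    field
      σ    : K F → K F
      σinv : K F → K F
      σlinv : ∀ a → σinv (σ a) ≡ a
      σrinv : ∀ a → σ (σinv a) ≡ a
      σ+ : ∀ a c → σ (_+ᴷ_ F a c) ≡ _+ᴷ_ F (σ a) (σ c)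
      σ* : ∀ a c → σ (_*ᴷ_ F a c) ≡ _*ᴷ_ F (σ a) (σ c)
      σ1 : σ (1ᴷ F) ≡ 1ᴷ F

record C3Data (n b : ℕ) (F : FiniteField b) : Set where
  field
    m      : ℕ
    bPrime : Prime b
    n≡mb   : n ≡ m * b
    _·_    : K F → V n → V n
    ·-distˡ : ∀ α u v → α · (u ⊕ v) ≡ (α · u) ⊕ (α · v)
    ·-distʳ : ∀ α β v → (_+ᴷ_ F α β) · v ≡ (α · v) ⊕ (β · v)
    ·-assoc : ∀ α β v → (_*ᴷ_ F α β) · v ≡ α · (β · v)
    ·-one   : ∀ v → (1ᴷ F) · v ≡ v
    B~      : V n → V n → K F
    B~-addˡ : ∀ u u' v → B~ (u ⊕ u') v ≡ _+ᴷ_ F (B~ u v) (B~ u' v)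
    B~-addʳ : ∀ u v v' → B~ u (v ⊕ v') ≡ _+ᴷ_ F (B~ u v) (B~ u v')
    B~-sclˡ : ∀ α u v → B~ (α · u) v ≡ _*ᴷ_ F α (B~ u v)
    B~-sclʳ : ∀ α u v → B~ u (α · v) ≡ _*ᴷ_ F α (B~ u v)
    B~-alt  : ∀ u → B~ u u ≡ 0ᴷ F
    B~-nondeg : ∀ u → (∀ v → B~ u v ≡ 0ᴷ F) → u ≡ 𝟎
    B≡TrB~  : ∀ u v → trace F (B~ u v) ≡ emb F (B n u v)
open C3Data public

-- g lies in the C₃-subgroup ΓSp_{2m}(2^b) ≅ Sp_{2m}(2^b) ⋊ C_b determined by S
InC3 : ∀ {n b} {F : FiniteField b} → C3Data n b F → Sp n → Set
InC3 {F = F} S g =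
  Σ (FieldAut F) λ s →
    (∀ α w → f g (_·_ S α w) ≡ _·_ S (FieldAut.σ s α) (f g w)) ×
    (∀ u v → B~ S (f g u) (f g v) ≡ FieldAut.σ s (B~ S u v))

{-# OPTIONS --safe #-}
-- Write G = X_Δ.  If a transvection t_v lay in the C₃-subgroup, comparing
-- t_v(αw) with α t_v(w) would force αv ∈ {0, v} for every scalar α, which is
-- absurd as the field has at least four elements.  So G contains no
-- transvection.  But t_v either fixes a form φ or sends it to φ + B(·,v), hence
-- every v ≠ 0 is the difference of some form in Δ and some form outside Δ, and
-- transitivity of G on Δ × (𝒬 ∖ Δ) makes G transitive on V ∖ {0}.  Therefore
-- F(v) = Σ_{φ ∈ Δ} (-1)^φ(v) is constant on V ∖ {0}.  If α ∈ Δ and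
-- β = α + B(·,u) ∉ Δ are interchanged by t_u, then β(x) = α(x + u), so
-- Σ_v F(v) (-1)^α(v) = Σ_v F(v) (-1)^β(v).  By orthogonality of characters the
-- left side is 2^{2n} and the right side is 0.
module Submission where

open import Defs
open import Algebra.Bundles using (CommutativeMonoid; CommutativeRing)
import Algebra.Properties.CommutativeSemigroup as CommutativeSemigroupProperties
open import Algebra.Structures using (IsCommutativeRing)
open import Data.Bool using (Bool; true; false; not; _xor_; _∧_; if_then_else_)
import Data.Bool.Properties as Bool
open import Data.Empty using (⊥)
open import Data.Fin using (Fin; zero; suc)
open import Data.Fin.Properties using (pigeonhole; <⇒≢) renaming (_≟_ to _≟ᶠ_)
open import Data.Integer as ℤ using (ℤ; 0ℤ; 1ℤ)
import Data.Integer.Properties as ℤ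
open import Data.Integer.Tactic.RingSolver using (solve-∀)
open import Data.List as List using (List; []; _∷_; foldr; length)
open import Data.List.Properties using (length-map; length-removeAt′)
open import Data.List.Relation.Unary.All as All using (All; []; _∷_)
import Data.List.Relation.Unary.All.Properties as All
open import Data.List.Relation.Unary.AllPairs using (AllPairs; []; _∷_)
import Data.List.Relation.Unary.AllPairs.Properties as AllPairs
open import Data.List.Relation.Unary.Any as Any using (Any; here; there; index; _─_)
import Data.List.Relation.Unary.Any.Properties as Any
open import Data.Nat as ℕ using (ℕ; zero; suc; _+_; _≤_; s≤s; z≤n)
import Data.Nat.Properties as ℕ
open import Data.Nat.Primality using (Prime)
open import Data.Product using (Σ; _×_; _,_; proj₁; proj₂)
open import Data.Vec as Vec using (Vec; []; _∷_; _++_; take; drop)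
open import Data.Vec.Properties using (take-zipWith; drop-zipWith; take++drop≡id; zipWith-assoc; zipWith-identityˡ; zipWith-identityʳ; ≡-dec)
open import Function using (_∘_)
open import Function.Bundles using (Inverse)
open import Relation.Binary using (DecidableEquality; IsEquivalence)
open import Relation.Binary.PropositionalEquality using (_≡_; _≢_; refl; sym; trans; cong; cong₂; subst; module ≡-Reasoning)
open import Relation.Nullary using (¬_; yes; no; contradiction)
open import Relation.Nullary.Decidable using (decidable-stable; map′)

open import Algebra.Properties.AbelianGroup ℤ.+-0-abelianGroup using () renaming (∙-cancelʳ to ℤ-+-cancelʳ)

private
  variable
    d : ℕ

-- Linear algebra over F₂

open CommutativeSemigroupProperties
  (CommutativeMonoid.commutativeSemigroup (CommutativeRing.+-commutativeMonoid Bool.xor-∧-commutativeRing))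
  using () renaming (interchange to xor-interchange)

xor-cancelˡ : ∀ a {b c} → a xor b ≡ a xor c → b ≡ c
xor-cancelˡ false eq = eq
xor-cancelˡ true  eq = Bool.not-injective eq

xor≡false⇒≡ : ∀ a b → a xor b ≡ false → a ≡ b
xor≡false⇒≡ false b eq = sym eq
xor≡false⇒≡ true true eq = refl

⊕-identityˡ : ∀ (u : Vec Bool d) → 𝟎 ⊕ u ≡ u
⊕-identityˡ = zipWith-identityˡ Bool.xor-identityˡ

⊕-identityʳ : ∀ (u : Vec Bool d) → u ⊕ 𝟎 ≡ u
⊕-identityʳ = zipWith-identityʳ Bool.xor-identityʳ

⊕-assoc : ∀ (u v w : Vec Bool d) → (u ⊕ v) ⊕ w ≡ u ⊕ (v ⊕ w)
⊕-assoc = zipWith-assoc Bool.xor-assoc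

⊕-same : ∀ (u : Vec Bool d) → u ⊕ u ≡ 𝟎
⊕-same []      = refl
⊕-same (a ∷ u) = cong₂ _∷_ (Bool.xor-same a) (⊕-same u)

⊕-interchange : ∀ (t u v w : Vec Bool d) → (t ⊕ u) ⊕ (v ⊕ w) ≡ (t ⊕ v) ⊕ (u ⊕ w)
⊕-interchange [] [] [] [] = refl
⊕-interchange (a ∷ t) (b ∷ u) (c ∷ v) (d ∷ w) =
  cong₂ _∷_ (xor-interchange a b c d) (⊕-interchange t u v w)

⊕-cancelˡ : ∀ (u : Vec Bool d) {v w} → u ⊕ v ≡ u ⊕ w → v ≡ w
⊕-cancelˡ []      {[]}    {[]}    eq = refl
⊕-cancelˡ (a ∷ u) {b ∷ v} {c ∷ w} eq =
  cong₂ _∷_ (xor-cancelˡ a (cong Vec.head eq)) (⊕-cancelˡ u (cong Vec.tail eq))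

⊕≡𝟎⇒≡ : ∀ (u v : Vec Bool d) → u ⊕ v ≡ 𝟎 → u ≡ v
⊕≡𝟎⇒≡ u v eq = ⊕-cancelˡ u (trans (⊕-same u) (sym eq))

additive⇒𝟎 : ∀ {l} (h : Vec Bool d → Vec Bool l) → (∀ u v → h (u ⊕ v) ≡ h u ⊕ h v) → h 𝟎 ≡ 𝟎
additive⇒𝟎 h h-add = ⊕-cancelˡ (h 𝟎)
  (trans (sym (h-add 𝟎 𝟎)) (trans (cong h (⊕-identityˡ 𝟎)) (sym (⊕-identityʳ (h 𝟎)))))

dot-comm : ∀ (u v : Vec Bool d) → dot u v ≡ dot v u
dot-comm []      []      = refl
dot-comm (a ∷ u) (b ∷ v) = cong₂ _xor_ (Bool.∧-comm a b) (dot-comm u v)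

dot-⊕ʳ : ∀ (u v w : Vec Bool d) → dot u (v ⊕ w) ≡ dot u v xor dot u w
dot-⊕ʳ [] [] [] = refl
dot-⊕ʳ (a ∷ u) (b ∷ v) (c ∷ w) =
  trans (cong₂ _xor_ (Bool.∧-distribˡ-xor a b c) (dot-⊕ʳ u v w))
        (xor-interchange (a ∧ b) (a ∧ c) (dot u v) (dot u w))

dot-𝟎ˡ : ∀ (u : Vec Bool d) → dot 𝟎 u ≡ false
dot-𝟎ˡ []      = refl
dot-𝟎ˡ (a ∷ u) = dot-𝟎ˡ u

dot-nondegenerate : ∀ (v : Vec Bool d) → (∀ u → dot u v ≡ false) → v ≡ 𝟎
dot-nondegenerate [] _ = refl
dot-nondegenerate (a ∷ v) v⊥ = cong₂ _∷_
  (trans (sym (trans (cong (a xor_) (dot-𝟎ˡ v)) (Bool.xor-identityʳ a))) (v⊥ (true ∷ 𝟎)))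
  (dot-nondegenerate v (λ u → v⊥ (false ∷ u)))

take-++ : ∀ k {l} (u : Vec Bool k) (v : Vec Bool l) → take k (u ++ v) ≡ u
take-++ zero    []      v = refl
take-++ (suc k) (a ∷ u) v = cong (a ∷_) (take-++ k u v)

drop-++ : ∀ k {l} (u : Vec Bool k) (v : Vec Bool l) → drop k (u ++ v) ≡ v
drop-++ zero    []      v = refl
drop-++ (suc k) (a ∷ u) v = drop-++ k u v

𝟎++𝟎 : ∀ k {l} → 𝟎 {k} ++ 𝟎 {l} ≡ 𝟎
𝟎++𝟎 zero    = refl
𝟎++𝟎 (suc k) = cong (false ∷_) (𝟎++𝟎 k)

module _ (n : ℕ) where

  B-⊕ʳ : ∀ u v w → B n u (v ⊕ w) ≡ B n u v xor B n u w
  B-⊕ʳ u v w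
    rewrite drop-zipWith {m = n} _xor_ v w | take-zipWith {m = n} _xor_ v w
          | dot-⊕ʳ (take n u) (drop n v) (drop n w) | dot-⊕ʳ (drop n u) (take n v) (take n w)
    = xor-interchange (dot (take n u) (drop n v)) _ _ _

  B-sym : ∀ u v → B n u v ≡ B n v u
  B-sym u v = trans
    (cong₂ _xor_ (dot-comm (take n u) (drop n v)) (dot-comm (drop n u) (take n v)))
    (Bool.xor-comm (dot (drop n v) (take n u)) _)

  B-⊕ˡ : ∀ u v w → B n (u ⊕ v) w ≡ B n u w xor B n v w
  B-⊕ˡ u v w = trans (B-sym (u ⊕ v) w) (trans (B-⊕ʳ w u v) (cong₂ _xor_ (B-sym w u) (B-sym w v)))

  B-alt : ∀ u → B n u u ≡ false
  B-alt u = trans (cong (dot (take n u) (drop n u) xor_) (dot-comm (drop n u) (take n u)))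
                  (Bool.xor-same (dot (take n u) (drop n u)))

  -- Testing `v` against vectors supported on one half of the basis pairs them with the opposite
  -- half of `v`, so each half vanishes by nondegeneracy of `dot`.
  B-nondegenerate : ∀ v → (∀ x → B n x v ≡ false) → v ≡ 𝟎
  B-nondegenerate v v⊥ = begin
    v                      ≡⟨ take++drop≡id n v ⟨
    take n v ++ drop n v   ≡⟨ cong₂ _++_ (dot-nondegenerate (take n v) take⊥) (dot-nondegenerate (drop n v) drop⊥) ⟩
    𝟎 {n} ++ 𝟎 {n}         ≡⟨ 𝟎++𝟎 n ⟩
    𝟎                      ∎
    where
    open ≡-Reasoning
    B-++ : ∀ a b → B n (a ++ b) v ≡ dot a (drop n v) xor dot b (take n v)
    B-++ a b = cong₂ _xor_ (cong (λ z → dot z (drop n v)) (take-++ n a b))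
                           (cong (λ z → dot z (take n v)) (drop-++ n a b))
    take⊥ : ∀ u → dot u (take n v) ≡ false
    take⊥ u = trans (cong (_xor dot u (take n v)) (sym (dot-𝟎ˡ (drop n v))))
                    (trans (sym (B-++ 𝟎 u)) (v⊥ (𝟎 {n} ++ u)))
    drop⊥ : ∀ u → dot u (drop n v) ≡ false
    drop⊥ u = trans (sym (trans (cong (dot u (drop n v) xor_) (dot-𝟎ˡ (take n v)))
                                (Bool.xor-identityʳ (dot u (drop n v)))))
                    (trans (sym (B-++ u 𝟎)) (v⊥ (u ++ 𝟎 {n})))

  B-injectiveʳ : ∀ u v → (∀ x → B n x u ≡ B n x v) → u ≡ v
  B-injectiveʳ u v eq = ⊕≡𝟎⇒≡ u v (B-nondegenerate (u ⊕ v) λ x →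
    trans (B-⊕ʳ x u v) (trans (cong (_xor B n x v) (eq x)) (Bool.xor-same (B n x v))))

-- The same expression as a summand of `comb`, so it serves both transvections and linear
-- combinations by mere unfolding.
scale : Bool → Vec Bool d → Vec Bool d
scale c v = if c then v else 𝟎

scale-xor : ∀ a b (v : Vec Bool d) → scale (a xor b) v ≡ scale a v ⊕ scale b v
scale-xor false b     v = sym (⊕-identityˡ (scale b v))
scale-xor true  false v = sym (⊕-identityʳ v)
scale-xor true  true  v = sym (⊕-same v)

-- Transvections

module _ (n : ℕ) (v : V n) where

  transvect : V n → V n
  transvect x = x ⊕ scale (B n x v) v

  B-scaleˡ : ∀ c x → B n (scale c v) x ≡ c ∧ B n v x
  B-scaleˡ true  x = refl
  B-scaleˡ false x = sym (xor-cancelˡ (B n 𝟎 x) (begin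
    B n 𝟎 x xor false     ≡⟨ Bool.xor-identityʳ _ ⟩
    B n 𝟎 x               ≡⟨ cong (λ z → B n z x) (⊕-identityˡ 𝟎) ⟨
    B n (𝟎 ⊕ 𝟎) x         ≡⟨ B-⊕ˡ n 𝟎 𝟎 x ⟩
    B n 𝟎 x xor B n 𝟎 x   ∎))
    where open ≡-Reasoning

  B-transvectˡ : ∀ x y → B n (transvect x) y ≡ B n x y xor (B n x v ∧ B n v y)
  B-transvectˡ x y = trans (B-⊕ˡ n x _ y) (cong (B n x y xor_) (B-scaleˡ (B n x v) y))

  -- Adding a multiple of `v` is invisible to `v` because `B n v v` vanishes. Hence a second
  -- application adds the same multiple again, which makes the transvection an involution.
  B-transvect-v : ∀ x → B n (transvect x) v ≡ B n x v
  B-transvect-v x = begin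
    B n (transvect x) v                  ≡⟨ B-transvectˡ x v ⟩
    B n x v xor (B n x v ∧ B n v v)      ≡⟨ cong (λ z → B n x v xor (B n x v ∧ z)) (B-alt n v) ⟩
    B n x v xor (B n x v ∧ false)        ≡⟨ cong (B n x v xor_) (Bool.∧-zeroʳ (B n x v)) ⟩
    B n x v xor false                    ≡⟨ Bool.xor-identityʳ _ ⟩
    B n x v                              ∎
    where open ≡-Reasoning

  transvect-involutive : ∀ x → transvect (transvect x) ≡ x
  transvect-involutive x = begin
    transvect x ⊕ scale (B n (transvect x) v) v             ≡⟨ cong (λ c → transvect x ⊕ scale c v) (B-transvect-v x) ⟩
    (x ⊕ scale (B n x v) v) ⊕ scale (B n x v) v             ≡⟨ ⊕-assoc x _ _ ⟩
    x ⊕ (scale (B n x v) v ⊕ scale (B n x v) v)             ≡⟨ cong (x ⊕_) (⊕-same _) ⟩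
    x ⊕ 𝟎                                                   ≡⟨ ⊕-identityʳ x ⟩
    x                                                       ∎
    where open ≡-Reasoning

  transvect-⊕ : ∀ x y → transvect (x ⊕ y) ≡ transvect x ⊕ transvect y
  transvect-⊕ x y = begin
    (x ⊕ y) ⊕ scale (B n (x ⊕ y) v) v                        ≡⟨ cong (λ c → (x ⊕ y) ⊕ scale c v) (B-⊕ˡ n x y v) ⟩
    (x ⊕ y) ⊕ scale (B n x v xor B n y v) v                  ≡⟨ cong ((x ⊕ y) ⊕_) (scale-xor (B n x v) (B n y v) v) ⟩
    (x ⊕ y) ⊕ (scale (B n x v) v ⊕ scale (B n y v) v)        ≡⟨ ⊕-interchange x y _ _ ⟩
    transvect x ⊕ transvect y                                ∎
    where open ≡-Reasoning

  -- The correction in each argument contributes `B n x v ∧ B n y v`, and the two copies cancel in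
  -- characteristic 2.
  B-transvect : ∀ x y → B n (transvect x) (transvect y) ≡ B n x y
  B-transvect x y = begin
    B n (transvect x) (transvect y)                                          ≡⟨ B-transvectˡ x (transvect y) ⟩
    B n x (transvect y) xor (B n x v ∧ B n v (transvect y))                  ≡⟨ cong₂ (λ a b → a xor (B n x v ∧ b)) (B-sym n x _) (trans (B-sym n v _) (B-transvect-v y)) ⟩
    B n (transvect y) x xor (B n x v ∧ B n y v)                              ≡⟨ cong (_xor (B n x v ∧ B n y v)) (B-transvectˡ y x) ⟩
    (B n y x xor (B n y v ∧ B n v x)) xor (B n x v ∧ B n y v)                ≡⟨ cong₂ (λ a b → (a xor (B n y v ∧ b)) xor (B n x v ∧ B n y v)) (B-sym n y x) (B-sym n v x) ⟩
    (B n x y xor (B n y v ∧ B n x v)) xor (B n x v ∧ B n y v)                ≡⟨ cong (λ a → (B n x y xor a) xor (B n x v ∧ B n y v)) (Bool.∧-comm (B n y v) (B n x v)) ⟩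
    (B n x y xor (B n x v ∧ B n y v)) xor (B n x v ∧ B n y v)                ≡⟨ Bool.xor-assoc (B n x y) _ _ ⟩
    B n x y xor ((B n x v ∧ B n y v) xor (B n x v ∧ B n y v))                ≡⟨ cong (B n x y xor_) (Bool.xor-same (B n x v ∧ B n y v)) ⟩
    B n x y xor false                                                        ≡⟨ Bool.xor-identityʳ _ ⟩
    B n x y                                                                  ∎
    where open ≡-Reasoning

  transvection : Sp n
  transvection = record
    { f = transvect ; finv = transvect
    ; linv = transvect-involutive ; rinv = transvect-involutive
    ; add = transvect-⊕ ; presB = B-transvect }

-- C₃-subgroups contain no transvections

module _ {b : ℕ} (F : FiniteField b) where

  -- Supplies the split of a scalar into zero or invertible that `∙-cancelʳ` relies on.
  _≟ᴷ_ : DecidableEquality (K F)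
  x ≟ᴷ y = map′ (λ eq → trans (sym (strictlyInverseʳ x)) (trans (cong from eq) (strictlyInverseʳ y)))
                (cong to) (to x ≟ᶠ to y)
    where open Inverse (card F)

  not-two-elements : 2 ≤ b → ¬ (∀ α → Σ Bool λ c → α ≡ emb F c)
  not-two-elements 2≤b α∈F₂ =
    -- `2 ≤ b` unfolds to `1 < b`, so the bound is `2 ^ 1 < 2 ^ b`; this is why `bit` lands in
    -- `Fin (2 ^ 1)`.
    let i , j , i<j , eq = pigeonhole (ℕ.^-monoʳ-< 2 (s≤s (s≤s z≤n)) 2≤b) (bit ∘ coord)
    in <⇒≢ i<j (begin
        i                                ≡⟨ strictlyInverseˡ i ⟨
        to (from i)                      ≡⟨ cong to (proj₂ (α∈F₂ (from i))) ⟩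
        to (emb F (coord i))             ≡⟨ cong (to ∘ emb F) (bit-injective (coord i) (coord j) eq) ⟩
        to (emb F (coord j))             ≡⟨ cong to (proj₂ (α∈F₂ (from j))) ⟨
        to (from j)                      ≡⟨ strictlyInverseˡ j ⟩
        j                                ∎)
    where
    open ≡-Reasoning
    open Inverse (card F)
    coord : Fin (2 ℕ.^ b) → Bool
    coord i = proj₁ (α∈F₂ (from i))
    bit : Bool → Fin (2 ℕ.^ 1)
    bit false = zero
    bit true  = suc zero
    bit-injective : ∀ c d → bit c ≡ bit d → c ≡ d
    bit-injective false false _ = refl
    bit-injective true  true  _ = refl

module _ {n b : ℕ} {F : FiniteField b} (S : C3Data n b F) where
  private
    module R = IsCommutativeRing (isCommRing F)
    infixr 8 _∙_
    _∙_ : K F → V n → V n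
    _∙_ = _·_ S

  ∙-zeroˡ : ∀ v → 0ᴷ F ∙ v ≡ 𝟎
  ∙-zeroˡ v = ⊕-cancelˡ (0ᴷ F ∙ v) (begin
    0ᴷ F ∙ v ⊕ 0ᴷ F ∙ v          ≡⟨ ·-distʳ S _ _ v ⟨
    (_+ᴷ_ F (0ᴷ F) (0ᴷ F)) ∙ v   ≡⟨ cong (_∙ v) (R.+-identityˡ (0ᴷ F)) ⟩
    0ᴷ F ∙ v                     ≡⟨ ⊕-identityʳ _ ⟨
    0ᴷ F ∙ v ⊕ 𝟎                 ∎)
    where open ≡-Reasoning

  ∙-emb : ∀ c v → emb F c ∙ v ≡ scale c v
  ∙-emb false v = ∙-zeroˡ v
  ∙-emb true  v = ·-one S v

  -- The difference of the two scalars kills `v`; were it nonzero, multiplying by its inverse would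
  -- give `v ≡ 𝟎`.
  ∙-cancelʳ : ∀ {α β v} → v ≢ 𝟎 → α ∙ v ≡ β ∙ v → α ≡ β
  ∙-cancelʳ {α} {β} {v} v≢𝟎 eq with _≟ᴷ_ F (_+ᴷ_ F α (-ᴷ_ F β)) (0ᴷ F)
  ... | yes δ≡0 = begin
    α                                        ≡⟨ R.+-identityʳ α ⟨
    _+ᴷ_ F α (0ᴷ F)                          ≡⟨ cong (_+ᴷ_ F α) (R.-‿inverseˡ β) ⟨
    _+ᴷ_ F α (_+ᴷ_ F (-ᴷ_ F β) β)            ≡⟨ R.+-assoc α _ β ⟨
    _+ᴷ_ F (_+ᴷ_ F α (-ᴷ_ F β)) β            ≡⟨ cong (λ z → _+ᴷ_ F z β) δ≡0 ⟩
    _+ᴷ_ F (0ᴷ F) β                          ≡⟨ R.+-identityˡ β ⟩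
    β                                        ∎
    where open ≡-Reasoning
  ... | no δ≢0 with δ⁻¹ , δδ⁻¹≡1 ← inverse F _ δ≢0 = contradiction v≡𝟎 v≢𝟎
    where
    open ≡-Reasoning
    δ : K F
    δ = _+ᴷ_ F α (-ᴷ_ F β)
    δv≡𝟎 : δ ∙ v ≡ 𝟎
    δv≡𝟎 = begin
      δ ∙ v                          ≡⟨ ·-distʳ S _ _ v ⟩
      α ∙ v ⊕ (-ᴷ_ F β) ∙ v          ≡⟨ cong (_⊕ (-ᴷ_ F β) ∙ v) eq ⟩
      β ∙ v ⊕ (-ᴷ_ F β) ∙ v          ≡⟨ ·-distʳ S _ _ v ⟨
      _+ᴷ_ F β (-ᴷ_ F β) ∙ v         ≡⟨ cong (_∙ v) (R.-‿inverseʳ β) ⟩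
      0ᴷ F ∙ v                       ≡⟨ ∙-zeroˡ v ⟩
      𝟎                              ∎
    v≡𝟎 : v ≡ 𝟎
    v≡𝟎 = begin
      v                              ≡⟨ ·-one S v ⟨
      1ᴷ F ∙ v                       ≡⟨ cong (_∙ v) δδ⁻¹≡1 ⟨
      _*ᴷ_ F δ δ⁻¹ ∙ v               ≡⟨ cong (_∙ v) (R.*-comm δ δ⁻¹) ⟩
      _*ᴷ_ F δ⁻¹ δ ∙ v               ≡⟨ ·-assoc S δ⁻¹ δ v ⟩
      δ⁻¹ ∙ δ ∙ v                    ≡⟨ cong (δ⁻¹ ∙_) δv≡𝟎 ⟩
      δ⁻¹ ∙ 𝟎                        ≡⟨ additive⇒𝟎 (δ⁻¹ ∙_) (·-distˡ S δ⁻¹) ⟩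
      𝟎                              ∎

  -- The trace of 0 is read off from B≡TrB~ at (v , v).
  B-line : ∀ α v → B n (α ∙ v) v ≡ false
  B-line α v = emb-injective (begin
    emb F (B n (α ∙ v) v)      ≡⟨ B≡TrB~ S (α ∙ v) v ⟨
    trace F (B~ S (α ∙ v) v)   ≡⟨ cong (trace F) B~-line ⟩
    trace F (B~ S v v)         ≡⟨ B≡TrB~ S v v ⟩
    emb F (B n v v)            ≡⟨ cong (emb F) (B-alt n v) ⟩
    emb F false                ∎)
    where
    open ≡-Reasoning
    B~-line : B~ S (α ∙ v) v ≡ B~ S v v
    B~-line = begin
      B~ S (α ∙ v) v           ≡⟨ B~-sclˡ S α v v ⟩
      _*ᴷ_ F α (B~ S v v)      ≡⟨ cong (_*ᴷ_ F α) (B~-alt S v) ⟩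
      _*ᴷ_ F α (0ᴷ F)          ≡⟨ R.zeroʳ α ⟩
      0ᴷ F                     ≡⟨ B~-alt S v ⟨
      B~ S v v                 ∎
    emb-injective : ∀ {c} → emb F c ≡ emb F false → c ≡ false
    emb-injective {false} _  = refl
    emb-injective {true}  eq = contradiction (sym eq) (0≢1 F)

  -- The transvection fixes the K-line through `v` pointwise, which forces its field automorphism to
  -- be trivial. A vector `w` not orthogonal to `v` would then make every scalar a bit, so `v` lies
  -- in the radical of `B`.
  transvection∉C₃ : ∀ v → v ≢ 𝟎 → ¬ InC3 S (transvection n v)
  transvection∉C₃ v v≢𝟎 (s , semilinear , _) = v≢𝟎 (B-nondegenerate n v Bwv≡false)
    where
    open FieldAut s using (σ)
    open ≡-Reasoning

    t : V n → V n
    t = transvect n v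

    t-fixes-line : ∀ α → t (α ∙ v) ≡ α ∙ v
    t-fixes-line α = trans (cong (λ c → α ∙ v ⊕ scale c v) (B-line α v)) (⊕-identityʳ (α ∙ v))

    tv≡v : t v ≡ v
    tv≡v = trans (cong (λ c → v ⊕ scale c v) (B-alt n v)) (⊕-identityʳ v)

    σ-id : ∀ α → σ α ≡ α
    σ-id α = ∙-cancelʳ v≢𝟎 (begin
      σ α ∙ v     ≡⟨ cong (σ α ∙_) tv≡v ⟨
      σ α ∙ t v   ≡⟨ semilinear α v ⟨
      t (α ∙ v)   ≡⟨ t-fixes-line α ⟩
      α ∙ v       ∎)

    -- Here `t w` is `w ⊕ v`. Expanding `α ∙ t w` directly, and again as `t (α ∙ w)`, and cancelling
    -- `α ∙ w` leaves `α ∙ v` equal to `v` or `𝟎`, according to the bit `B n (α ∙ w) v`.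
    scalar-bit : ∀ w → B n w v ≡ true → ∀ α → α ≡ emb F (B n (α ∙ w) v)
    scalar-bit w Bwv α = ∙-cancelʳ v≢𝟎 (trans (⊕-cancelˡ (α ∙ w) (begin
      α ∙ w ⊕ α ∙ v                        ≡⟨ ·-distˡ S α w v ⟨
      α ∙ (w ⊕ v)                          ≡⟨ cong (λ c → α ∙ (w ⊕ scale c v)) Bwv ⟨
      α ∙ t w                              ≡⟨ cong (_∙ t w) (σ-id α) ⟨
      σ α ∙ t w                            ≡⟨ semilinear α w ⟨
      α ∙ w ⊕ scale (B n (α ∙ w) v) v      ∎)) (sym (∙-emb _ v)))

    2≤prime : ∀ {p} → Prime p → 2 ≤ p
    2≤prime {suc (suc _)} _ = s≤s (s≤s z≤n)

    Bwv≡false : ∀ w → B n w v ≡ false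
    Bwv≡false w = Bool.¬-not λ Bwv →
      not-two-elements F (2≤prime (bPrime S)) λ α → B n (α ∙ w) v , scalar-bit w Bwv α

-- Character sums

χ : Bool → ℤ
χ false = 1ℤ
χ true  = ℤ.- 1ℤ

χ-xor : ∀ a b → χ (a xor b) ≡ χ a ℤ.* χ b
χ-xor false false = refl
χ-xor false true  = refl
χ-xor true  false = refl
χ-xor true  true  = refl

-- Recursion on coordinates makes translation invariance elementary: a leading `true` in the
-- translating vector just swaps the two halves of the sum.
sumV : (Vec Bool d → ℤ) → ℤ
sumV {zero}  h = h []
sumV {suc d} h = sumV (λ x → h (false ∷ x)) ℤ.+ sumV (λ x → h (true ∷ x))

sumV-cong : ∀ {h k : Vec Bool d → ℤ} → (∀ x → h x ≡ k x) → sumV h ≡ sumV k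
sumV-cong {zero}  eq = eq []
sumV-cong {suc d} eq = cong₂ ℤ._+_ (sumV-cong (eq ∘ (false ∷_))) (sumV-cong (eq ∘ (true ∷_)))

sumV-+ : ∀ (h k : Vec Bool d → ℤ) → sumV (λ x → h x ℤ.+ k x) ≡ sumV h ℤ.+ sumV k
sumV-+ {zero}  h k = refl
sumV-+ {suc d} h k = trans
  (cong₂ ℤ._+_ (sumV-+ (h ∘ (false ∷_)) (k ∘ (false ∷_))) (sumV-+ (h ∘ (true ∷_)) (k ∘ (true ∷_))))
  (ℤ-interchange (sumV (h ∘ (false ∷_))) (sumV (k ∘ (false ∷_))) (sumV (h ∘ (true ∷_))) (sumV (k ∘ (true ∷_))))
  where
  ℤ-interchange : ∀ x y z w → (x ℤ.+ y) ℤ.+ (z ℤ.+ w) ≡ (x ℤ.+ z) ℤ.+ (y ℤ.+ w)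
  ℤ-interchange = solve-∀

sumV-*ˡ : ∀ c (h : Vec Bool d → ℤ) → sumV (λ x → c ℤ.* h x) ≡ c ℤ.* sumV h
sumV-*ˡ {zero}  c h = refl
sumV-*ˡ {suc d} c h = trans
  (cong₂ ℤ._+_ (sumV-*ˡ c (h ∘ (false ∷_))) (sumV-*ˡ c (h ∘ (true ∷_))))
  (sym (ℤ.*-distribˡ-+ c (sumV (h ∘ (false ∷_))) (sumV (h ∘ (true ∷_)))))

sumV-translate : ∀ (u : Vec Bool d) (h : Vec Bool d → ℤ) → sumV (λ x → h (u ⊕ x)) ≡ sumV h
sumV-translate []          h = refl
sumV-translate (false ∷ u) h = cong₂ ℤ._+_ (sumV-translate u (h ∘ (false ∷_))) (sumV-translate u (h ∘ (true ∷_)))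
sumV-translate (true  ∷ u) h =
  trans (cong₂ ℤ._+_ (sumV-translate u (h ∘ (true ∷_))) (sumV-translate u (h ∘ (false ∷_)))) (ℤ.+-comm (sumV (h ∘ (true ∷_))) (sumV (h ∘ (false ∷_))))

sumV-1>0 : ∀ d → 0ℤ ℤ.< sumV {d} (λ _ → 1ℤ)
sumV-1>0 zero    = ℤ.+<+ (s≤s z≤n)
sumV-1>0 (suc d) = ℤ.+-mono-< (sumV-1>0 d) (sumV-1>0 d)

-- Translating the summation variable by `u` negates every term, so the sum equals its own negative.
character-sum≡0 : ∀ (h : Vec Bool d → Bool) → (∀ x y → h (x ⊕ y) ≡ h x xor h y) →
                  ∀ u → h u ≡ true → sumV (χ ∘ h) ≡ 0ℤ
character-sum≡0 h h-add u hu = s≡-s⇒s≡0 (sumV (χ ∘ h)) (begin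
  sumV (χ ∘ h)                      ≡⟨ sumV-translate u (χ ∘ h) ⟨
  sumV (λ x → χ (h (u ⊕ x)))        ≡⟨ sumV-cong (λ x → trans (cong χ (h-add u x)) (trans (χ-xor (h u) (h x)) (cong (λ c → χ c ℤ.* χ (h x)) hu))) ⟩
  sumV (λ x → ℤ.- 1ℤ ℤ.* χ (h x))   ≡⟨ sumV-*ˡ (ℤ.- 1ℤ) (χ ∘ h) ⟩
  ℤ.- 1ℤ ℤ.* sumV (χ ∘ h)           ≡⟨ ℤ.-1*i≡-i _ ⟩
  ℤ.- sumV (χ ∘ h)                  ∎)
  where
  open ≡-Reasoning
  s≡-s⇒s≡0 : ∀ s → s ≡ ℤ.- s → s ≡ 0ℤ
  -- For a nonzero integer the two sides have different constructors, so unification discards those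
  -- cases.
  s≡-s⇒s≡0 (ℤ.+ zero) _ = refl

-- Every term is 1. The strict inequality is what later contradicts a vanishing sum of correlations.
character-sum>0 : ∀ (h : Vec Bool d → Bool) → (∀ x → h x ≡ false) → 0ℤ ℤ.< sumV (χ ∘ h)
character-sum>0 {d} h h≡0 =
  subst (0ℤ ℤ.<_) (sumV-cong {d} {λ _ → χ false} (λ x → cong χ (sym (h≡0 x)))) (sumV-1>0 d)

-- Sums over lists of distinct elements

module _ {A : Set} where

  sumL : (A → ℤ) → List A → ℤ
  sumL h = foldr (λ x s → h x ℤ.+ s) 0ℤ

  sumL-≡0 : ∀ {h : A → ℤ} {xs} → All (λ x → h x ≡ 0ℤ) xs → sumL h xs ≡ 0ℤ
  sumL-≡0 []         = refl
  sumL-≡0 (eq ∷ eqs) = cong₂ ℤ._+_ eq (sumL-≡0 eqs)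

  sumL-≥0 : ∀ {h : A → ℤ} (h≥0 : ∀ x → 0ℤ ℤ.≤ h x) xs → 0ℤ ℤ.≤ sumL h xs
  sumL-≥0 h≥0 []       = ℤ.≤-refl
  sumL-≥0 h≥0 (x ∷ xs) = ℤ.+-mono-≤ (h≥0 x) (sumL-≥0 h≥0 xs)

  sumL->0 : ∀ {h : A → ℤ} (h≥0 : ∀ x → 0ℤ ℤ.≤ h x) {xs} → Any (λ x → 0ℤ ℤ.< h x) xs → 0ℤ ℤ.< sumL h xs
  sumL->0 h≥0 {x ∷ xs} (here h>0)  = ℤ.+-mono-<-≤ h>0 (sumL-≥0 h≥0 xs)
  sumL->0 h≥0 {x ∷ xs} (there any) = ℤ.+-mono-≤-< (h≥0 x) (sumL->0 h≥0 any)

  -- Interchange of summation; it turns the pairing of a sign sum with a form into a sum of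
  -- correlations.
  sumV-sumL : ∀ (h : A → Vec Bool d → ℤ) (k : Vec Bool d → ℤ) xs →
              sumV (λ v → sumL (λ x → h x v) xs ℤ.* k v) ≡ sumL (λ x → sumV (λ v → h x v ℤ.* k v)) xs
  sumV-sumL h k [] = sumV-*ˡ 0ℤ k
  sumV-sumL h k (x ∷ xs) = begin
    sumV (λ v → (h x v ℤ.+ sumL (λ y → h y v) xs) ℤ.* k v)
      ≡⟨ sumV-cong (λ v → ℤ.*-distribʳ-+ (k v) (h x v) _) ⟩
    sumV (λ v → h x v ℤ.* k v ℤ.+ sumL (λ y → h y v) xs ℤ.* k v)
      ≡⟨ sumV-+ (λ v → h x v ℤ.* k v) (λ v → sumL (λ y → h y v) xs ℤ.* k v) ⟩
    sumV (λ v → h x v ℤ.* k v) ℤ.+ sumV (λ v → sumL (λ y → h y v) xs ℤ.* k v)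
      ≡⟨ cong (ℤ._+_ (sumV (λ v → h x v ℤ.* k v))) (sumV-sumL h k xs) ⟩
    sumL (λ y → sumV (λ v → h y v ℤ.* k v)) (x ∷ xs) ∎
    where open ≡-Reasoning

  module _ {_≈_ : A → A → Set} (≈-equiv : IsEquivalence _≈_) where
    private module E = IsEquivalence ≈-equiv

    -- If the removed entry were the one matching `y`, it would be equivalent to both `x` and `y`.
    ∈-─ : ∀ {x y ys} (x∈ys : Any (x ≈_) ys) → Any (y ≈_) ys → ¬ (x ≈ y) → Any (y ≈_) (ys ─ x∈ys)
    ∈-─ (here x≈z)   (here y≈z)   x≉y = contradiction (E.trans x≈z (E.sym y≈z)) x≉y
    ∈-─ (here _)     (there y∈ys) x≉y = y∈ys
    ∈-─ (there _)    (here y≈z)   x≉y = here y≈z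
    ∈-─ (there x∈ys) (there y∈ys) x≉y = there (∈-─ x∈ys y∈ys x≉y)

    module _ {h : A → ℤ} (h-resp : ∀ {x y} → x ≈ y → h x ≡ h y) where

      sumL-─ : ∀ {x ys} (x∈ys : Any (x ≈_) ys) → h x ℤ.+ sumL h (ys ─ x∈ys) ≡ sumL h ys
      sumL-─ {ys = y ∷ ys} (here x≈y) = cong (ℤ._+ sumL h ys) (h-resp x≈y)
      sumL-─ {x} {y ∷ ys} (there x∈ys) =
        trans (swap (h x) (h y) _) (cong (ℤ._+_ (h y)) (sumL-─ x∈ys))
        where
        swap : ∀ i j k → i ℤ.+ (j ℤ.+ k) ≡ j ℤ.+ (i ℤ.+ k)
        swap = solve-∀

      -- Entries of `xs` are matched and removed from `ys` one at a time. Distinctness keeps the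
      -- remaining matches intact, and the length equation, in place of a reverse inclusion, makes
      -- both lists end together.
      sumL-⊆ : ∀ {xs ys} → AllPairs (λ x y → ¬ (x ≈ y)) xs → All (λ x → Any (x ≈_) ys) xs →
               length ys ≡ length xs → sumL h xs ≡ sumL h ys
      sumL-⊆ {[]} {[]} _ _ _ = refl
      sumL-⊆ {x ∷ xs} {ys} (x∉xs ∷ distinct) (x∈ys ∷ xs⊆ys) |ys|≡|xs| =
        trans (cong (ℤ._+_ (h x)) (sumL-⊆ distinct
                (All.zipWith (λ (x≉y , y∈ys) → ∈-─ x∈ys y∈ys x≉y) (x∉xs , xs⊆ys))
                (ℕ.suc-injective (trans (sym (length-removeAt′ ys (index x∈ys))) |ys|≡|xs|))))
              (sumL-─ x∈ys)

sumL-map : ∀ {A C : Set} (h : A → ℤ) (k : C → A) xs → sumL h (List.map k xs) ≡ sumL (h ∘ k) xs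
sumL-map h k []       = refl
sumL-map h k (x ∷ xs) = cong (ℤ._+_ (h (k x))) (sumL-map h k xs)

-- Quadratic forms

comb-map : ∀ {k l} (h : Vec Bool k → Vec Bool l) → (∀ u v → h (u ⊕ v) ≡ h u ⊕ h v) →
           ∀ {d} (c : Vec Bool d) vs → comb c (Vec.map h vs) ≡ h (comb c vs)
comb-map h h-add []       []       = sym (additive⇒𝟎 h h-add)
comb-map h h-add (c ∷ cs) (v ∷ vs) =
  trans (cong₂ _⊕_ (h-scale c) (comb-map h h-add cs vs)) (sym (h-add (scale c v) (comb cs vs)))
  where
  h-scale : ∀ c → scale c (h v) ≡ h (scale c v)
  h-scale false = sym (additive⇒𝟎 h h-add)
  h-scale true  = refl

-- The images of the spanning vectors under `h` work: the left inverse `h⁻¹` preserves independence,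
-- and `ψ ∘ h` agreeing with `φ` preserves singularity.
singular-transport : ∀ n (φ ψ : V n → Bool) (h h⁻¹ : V n → V n) → (∀ u v → h (u ⊕ v) ≡ h u ⊕ h v) →
                     (∀ v → h⁻¹ (h v) ≡ v) → (∀ v → ψ (h v) ≡ φ v) →
                     HasMaxTotSingular n φ → HasMaxTotSingular n ψ
singular-transport n φ ψ h h⁻¹ h-add h⁻¹h≡id ψh≡φ (vs , independent , singular) =
  Vec.map h vs ,
  (λ c eq → independent c (begin
    comb c vs             ≡⟨ h⁻¹h≡id (comb c vs) ⟨
    h⁻¹ (h (comb c vs))   ≡⟨ cong h⁻¹ (trans (sym (comb-map h h-add c vs)) eq) ⟩
    h⁻¹ 𝟎                 ≡⟨ cong h⁻¹ (additive⇒𝟎 h h-add) ⟨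
    h⁻¹ (h 𝟎)             ≡⟨ h⁻¹h≡id 𝟎 ⟩
    𝟎                     ∎)) ,
  (λ c → trans (cong ψ (comb-map h h-add c vs)) (trans (ψh≡φ (comb c vs)) (singular c)))
  where open ≡-Reasoning

module _ {n : ℕ} (g : Sp n) where

  finv-⊕ : ∀ u v → finv g (u ⊕ v) ≡ finv g u ⊕ finv g v
  finv-⊕ u v = begin
    finv g (u ⊕ v)                           ≡⟨ cong₂ (λ x y → finv g (x ⊕ y)) (rinv g u) (rinv g v) ⟨
    finv g (f g (finv g u) ⊕ f g (finv g v)) ≡⟨ cong (finv g) (add g _ _) ⟨
    finv g (f g (finv g u ⊕ finv g v))       ≡⟨ linv g _ ⟩
    finv g u ⊕ finv g v                      ∎
    where open ≡-Reasoning

  image-type : ∀ ε {φ} → HasType n ε φ → HasType n ε (φ ∘ finv g)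
  image-type plus  {φ} = singular-transport n φ (φ ∘ finv g) (f g) (finv g) (add g) (linv g) (λ v → cong φ (linv g v))
  -- Type minus is a negation, so the transport runs backwards, from the image form to `φ` along
  -- `finv g`.
  image-type minus {φ} = _∘ singular-transport n (φ ∘ finv g) φ (finv g) (f g) finv-⊕ (rinv g) (λ v → refl)

  image : ∀ {ε} → QForm n ε → QForm n ε
  image {ε} φ = record
    { q     = q φ ∘ finv g
    ; polar = λ x y → begin
        (q φ (finv g (x ⊕ y)) xor q φ (finv g x)) xor q φ (finv g y)
          ≡⟨ cong (λ z → (q φ z xor q φ (finv g x)) xor q φ (finv g y)) (finv-⊕ x y) ⟩
        (q φ (finv g x ⊕ finv g y) xor q φ (finv g x)) xor q φ (finv g y)
          ≡⟨ polar φ (finv g x) (finv g y) ⟩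
        B n (finv g x) (finv g y)
          ≡⟨ presB g (finv g x) (finv g y) ⟨
        B n (f g (finv g x)) (f g (finv g y))
          ≡⟨ cong₂ (B n) (rinv g x) (rinv g y) ⟩
        B n x y ∎
    ; type  = image-type ε (type φ) }
    where open ≡-Reasoning

module _ {n : ℕ} {ε : Sign} where

  q-⊕ : ∀ (φ : QForm n ε) x y → q φ (x ⊕ y) ≡ (q φ x xor q φ y) xor B n x y
  q-⊕ φ x y = trans (move (q φ (x ⊕ y)) (q φ x) (q φ y)) (cong ((q φ x xor q φ y) xor_) (polar φ x y))
    where
    move : ∀ a b c → a ≡ (b xor c) xor ((a xor b) xor c)
    move false false false = refl
    move false false true  = refl
    move false true  false = refl
    move false true  true  = refl
    move true  false false = refl
    move true  false true  = refl
    move true  true  false = refl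
    move true  true  true  = refl

  q-𝟎 : ∀ (φ : QForm n ε) → q φ 𝟎 ≡ false
  q-𝟎 φ = begin
    q φ 𝟎                             ≡⟨ cong (q φ) (⊕-identityˡ 𝟎) ⟨
    q φ (𝟎 ⊕ 𝟎)                       ≡⟨ q-⊕ φ 𝟎 𝟎 ⟩
    (q φ 𝟎 xor q φ 𝟎) xor B n 𝟎 𝟎     ≡⟨ cong₂ _xor_ (Bool.xor-same (q φ 𝟎)) (B-alt n 𝟎) ⟩
    false                             ∎
    where open ≡-Reasoning

  -- Both forms polarise to the same `B`, so the polar terms cancel and the sum of two forms is
  -- linear. This brings the character sums into play.
  q-xor-additive : ∀ (φ ψ : QForm n ε) x y →
                   q φ (x ⊕ y) xor q ψ (x ⊕ y) ≡ (q φ x xor q ψ x) xor (q φ y xor q ψ y)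
  q-xor-additive φ ψ x y = begin
    q φ (x ⊕ y) xor q ψ (x ⊕ y)
      ≡⟨ cong₂ _xor_ (q-⊕ φ x y) (q-⊕ ψ x y) ⟩
    ((q φ x xor q φ y) xor B n x y) xor ((q ψ x xor q ψ y) xor B n x y)
      ≡⟨ xor-interchange (q φ x xor q φ y) (B n x y) (q ψ x xor q ψ y) (B n x y) ⟩
    ((q φ x xor q φ y) xor (q ψ x xor q ψ y)) xor (B n x y xor B n x y)
      ≡⟨ cong₂ _xor_ (xor-interchange (q φ x) (q φ y) (q ψ x) (q ψ y)) (Bool.xor-same (B n x y)) ⟩
    ((q φ x xor q ψ x) xor (q φ y xor q ψ y)) xor false
      ≡⟨ Bool.xor-identityʳ _ ⟩
    (q φ x xor q ψ x) xor (q φ y xor q ψ y) ∎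
    where open ≡-Reasoning

  -- The source of the dichotomy: the transvection fixes `φ` when `q φ v` is `true`, and otherwise
  -- adds the linear form pairing with `v`.
  q-transvect : ∀ (φ : QForm n ε) v x → q φ (transvect n v x) ≡ q φ x xor (B n x v ∧ not (q φ v))
  q-transvect φ v x with B n x v in Bxv
  ... | false = trans (cong (q φ) (⊕-identityʳ x)) (sym (Bool.xor-identityʳ (q φ x)))
  ... | true  = trans (q-⊕ φ x v) (trans (cong ((q φ x xor q φ v) xor_) Bxv)
                  (trans (Bool.xor-assoc (q φ x) (q φ v) true) (cong (q φ x xor_) (Bool.xor-comm (q φ v) true))))

  -- The inner product of two sign functions, which is the character sum of the linear form `φ + ψ`.
  correlation : QForm n ε → QForm n ε → ℤ
  correlation φ ψ = sumV (λ v → χ (q φ v) ℤ.* χ (q ψ v))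

  private
    correlation-χ : ∀ φ ψ → sumV (λ v → χ (q φ v xor q ψ v)) ≡ correlation φ ψ
    correlation-χ φ ψ = sumV-cong λ v → χ-xor (q φ v) (q ψ v)

  ≈Q⇒correlation>0 : ∀ φ ψ → φ ≈Q ψ → 0ℤ ℤ.< correlation φ ψ
  ≈Q⇒correlation>0 φ ψ φ≈ψ = subst (0ℤ ℤ.<_) (correlation-χ φ ψ)
    (character-sum>0 _ λ x → trans (cong (_xor q ψ x) (φ≈ψ x)) (Bool.xor-same (q ψ x)))

  -- Orthogonality of distinct forms, in contrapositive form: decidable equality of integers can
  -- then settle whether two forms agree.
  correlation≢0⇒≈Q : ∀ φ ψ → correlation φ ψ ≢ 0ℤ → φ ≈Q ψ
  correlation≢0⇒≈Q φ ψ c≢0 x = xor≡false⇒≡ (q φ x) (q ψ x) (Bool.¬-not λ φx≢ψx →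
    c≢0 (trans (sym (correlation-χ φ ψ)) (character-sum≡0 _ (q-xor-additive φ ψ) x φx≢ψx)))

  correlation≥0 : ∀ φ ψ → 0ℤ ℤ.≤ correlation φ ψ
  correlation≥0 φ ψ with correlation φ ψ ℤ.≟ 0ℤ
  ... | yes c≡0 = ℤ.≤-reflexive (sym c≡0)
  ... | no  c≢0 = ℤ.<⇒≤ (≈Q⇒correlation>0 φ ψ (correlation≢0⇒≈Q φ ψ c≢0))

  -- Pairs in Δ × (𝒬 ∖ Δ) that are interchanged by the transvection with centre v.
  record CrossPair (Δ : Subset n ε) (v : V n) : Set where
    field
      {α β}  : QForm n ε
      α∈Δ    : mem Δ α ≡ true
      β∉Δ    : mem Δ β ≡ false
      αv≡0   : q α v ≡ false
      β≈α+v  : ∀ x → q β x ≡ q α x xor B n x v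

    -- Since `α` vanishes at `v`, the form `β` is the translate of `α` by `v`.
    charSum-α≡β : sumV (χ ∘ q α) ≡ sumV (χ ∘ q β)
    charSum-α≡β = begin
      sumV (χ ∘ q α)               ≡⟨ sumV-translate v (χ ∘ q α) ⟨
      sumV (λ x → χ (q α (v ⊕ x))) ≡⟨ sumV-cong (λ x → cong χ (αvx x)) ⟩
      sumV (χ ∘ q β)               ∎
      where
      open ≡-Reasoning
      αvx : ∀ x → q α (v ⊕ x) ≡ q β x
      αvx x = begin
        q α (v ⊕ x)                    ≡⟨ q-⊕ α v x ⟩
        (q α v xor q α x) xor B n v x  ≡⟨ cong₂ (λ a b → (a xor q α x) xor b) αv≡0 (B-sym n v x) ⟩
        q α x xor B n x v              ≡⟨ β≈α+v x ⟨
        q β x                          ∎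

  -- By `q-transvect`, a form with value `true` at `v` is fixed and cannot change membership. So `ψ`
  -- is `φ` plus the pairing with `v`, a symmetric relation, and whichever form lies in `Δ` becomes
  -- `α`.
  moved⇒CrossPair : ∀ (Δ : Subset n ε) v φ ψ → Img (transvection n v) φ ψ → mem Δ φ ≢ mem Δ ψ → CrossPair Δ v
  moved⇒CrossPair Δ v φ ψ img φ≢ψ = case (mem Δ φ) refl
    where
    open ≡-Reasoning
    φv≡0 : q φ v ≡ false
    φv≡0 = Bool.¬-not λ φv≡1 → φ≢ψ (resp Δ φ ψ λ x → sym (begin
      q ψ x                                ≡⟨ img x ⟩
      q φ (transvect n v x)                ≡⟨ q-transvect φ v x ⟩
      q φ x xor (B n x v ∧ not (q φ v))    ≡⟨ cong (λ c → q φ x xor (B n x v ∧ not c)) φv≡1 ⟩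
      q φ x xor (B n x v ∧ false)          ≡⟨ cong (q φ x xor_) (Bool.∧-zeroʳ (B n x v)) ⟩
      q φ x xor false                      ≡⟨ Bool.xor-identityʳ (q φ x) ⟩
      q φ x                                ∎))

    ψ≈φ+v : ∀ x → q ψ x ≡ q φ x xor B n x v
    ψ≈φ+v x = begin
      q ψ x                                ≡⟨ img x ⟩
      q φ (transvect n v x)                ≡⟨ q-transvect φ v x ⟩
      q φ x xor (B n x v ∧ not (q φ v))    ≡⟨ cong (λ c → q φ x xor (B n x v ∧ not c)) φv≡0 ⟩
      q φ x xor (B n x v ∧ true)           ≡⟨ cong (q φ x xor_) (Bool.∧-identityʳ (B n x v)) ⟩
      q φ x xor B n x v                    ∎

    φ≈ψ+v : ∀ x → q φ x ≡ q ψ x xor B n x v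
    φ≈ψ+v x = begin
      q φ x                                ≡⟨ Bool.xor-identityʳ (q φ x) ⟨
      q φ x xor false                      ≡⟨ cong (q φ x xor_) (Bool.xor-same (B n x v)) ⟨
      q φ x xor (B n x v xor B n x v)      ≡⟨ Bool.xor-assoc (q φ x) _ _ ⟨
      (q φ x xor B n x v) xor B n x v      ≡⟨ cong (_xor B n x v) (ψ≈φ+v x) ⟨
      q ψ x xor B n x v                    ∎

    case : ∀ c → mem Δ φ ≡ c → CrossPair Δ v
    case true  φ∈Δ = record
      { α∈Δ = φ∈Δ ; β∉Δ = Bool.¬-not (λ ψ∈Δ → φ≢ψ (trans φ∈Δ (sym ψ∈Δ)))
      ; αv≡0 = φv≡0 ; β≈α+v = ψ≈φ+v }
    case false φ∉Δ = record
      { α∈Δ = Bool.¬-not (λ ψ∉Δ → φ≢ψ (trans φ∉Δ (sym ψ∉Δ))) ; β∉Δ = φ∉Δ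
      ; αv≡0 = trans (ψ≈φ+v v) (cong₂ _xor_ φv≡0 (B-alt n v)) ; β≈α+v = φ≈ψ+v }

  -- Sign sums over a codeword

  module _ (Δ : Subset n ε) {k : ℕ} (Δ-size : HasSize Δ k) where
    private
      L : List (QForm n ε)
      L = proj₁ Δ-size
      distinct : AllPairs (λ φ ψ → ¬ (φ ≈Q ψ)) L
      distinct = proj₁ (proj₂ (proj₂ Δ-size))
      L⊆Δ : All (λ φ → mem Δ φ ≡ true) L
      L⊆Δ = proj₁ (proj₂ (proj₂ (proj₂ Δ-size)))
      Δ⊆L : ∀ φ → mem Δ φ ≡ true → Any (φ ≈Q_) L
      Δ⊆L = proj₂ (proj₂ (proj₂ (proj₂ Δ-size)))

    -- The function F, computed over the enumeration of `Δ` that `Δ-size` carries.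
    signSum : V n → ℤ
    signSum v = sumL (λ φ → χ (q φ v)) L

    -- Composing the listed forms with `g` only permutes `Δ`, up to pointwise equality.
    signSum-stab : ∀ g → Stab Δ g → ∀ v → signSum v ≡ signSum (f g v)
    signSum-stab g g∈G v = begin
      -- Forms are replaced by their underlying functions, so that `q φ ∘ f g` need not be
      -- repackaged as a `QForm`.
      signSum v                                               ≡⟨ sumL-map (λ p → χ (p v)) q L ⟨
      sumL (λ p → χ (p v)) (List.map q L)                     ≡⟨ sumL-⊆ ≗-equiv (λ eq → cong χ (eq v)) (AllPairs.map⁺ distinct) (All.map⁺ (All.map L⊆Lg L⊆Δ)) (trans (length-map _ L) (sym (length-map _ L))) ⟩
      sumL (λ p → χ (p v)) (List.map (λ φ → q φ ∘ f g) L)     ≡⟨ sumL-map (λ p → χ (p v)) (λ φ → q φ ∘ f g) L ⟩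
      signSum (f g v)                                         ∎
      where
      open ≡-Reasoning
      ≗-equiv : IsEquivalence (λ (p r : V n → Bool) → ∀ x → p x ≡ r x)
      ≗-equiv = record { refl = λ _ → refl ; sym = λ eq x → sym (eq x) ; trans = λ eq eq′ x → trans (eq x) (eq′ x) }
      L⊆Lg : ∀ {φ} → mem Δ φ ≡ true → Any (λ p → ∀ x → q φ x ≡ p x) (List.map (λ ψ → q ψ ∘ f g) L)
      L⊆Lg {φ} φ∈Δ = Any.map⁺ (Any.map
        (λ eq x → trans (cong (q φ) (sym (linv g x))) (eq (f g x)))
        -- The image of `φ` under `g` stays in `Δ`, hence is listed; composing its listed copy with
        -- `f g` recovers `φ`.
        (Δ⊆L (image g φ) (trans (sym (g∈G φ (image g φ) (λ _ → refl))) φ∈Δ)))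

    signSum-correlation : ∀ γ → sumV (λ v → signSum v ℤ.* χ (q γ v)) ≡ sumL (λ φ → correlation φ γ) L
    signSum-correlation γ = sumV-sumL (λ φ v → χ (q φ v)) (χ ∘ q γ) L

    -- No term is negative, and the listed copy of `γ` contributes a positive one.
    ∈Δ⇒correlation>0 : ∀ γ → mem Δ γ ≡ true → 0ℤ ℤ.< sumL (λ φ → correlation φ γ) L
    ∈Δ⇒correlation>0 γ γ∈Δ = sumL->0 (λ φ → correlation≥0 φ γ)
      (Any.map (λ {φ} γ≈φ → ≈Q⇒correlation>0 φ γ (λ x → sym (γ≈φ x))) (Δ⊆L γ γ∈Δ))

    -- A nonzero term would identify `γ` with a listed form and so put it in `Δ`.
    ∉Δ⇒correlation≡0 : ∀ γ → mem Δ γ ≡ false → sumL (λ φ → correlation φ γ) L ≡ 0ℤ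
    ∉Δ⇒correlation≡0 γ γ∉Δ = sumL-≡0 (All.map (λ {φ} φ∈Δ →
      decidable-stable (correlation φ γ ℤ.≟ 0ℤ) λ c≢0 →
        contradiction (trans (sym φ∈Δ) (trans (resp Δ φ γ (correlation≢0⇒≈Q φ γ c≢0)) γ∉Δ)) λ ()) L⊆Δ)

    -- The product `(signSum v - c) * (χ (q α v) - χ (q β v))` vanishes for every `v`. Summing its
    -- expansion over the whole space avoids singling out the zero vector, and the terms in `c`
    -- cancel by `charSum-α≡β`.
    signSum-constant⇒⊥ : ∀ {u} → CrossPair Δ u → ∀ c → (∀ v → v ≢ 𝟎 → signSum v ≡ c) → ⊥
    signSum-constant⇒⊥ cross c F≡c = ℤ.<-irrefl (sym (begin
      sumL (λ φ → correlation φ α) L            ≡⟨ signSum-correlation α ⟨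
      sumV (λ v → signSum v ℤ.* χ (q α v))      ≡⟨ ℤ-+-cancelʳ (c ℤ.* sumV (χ ∘ q α)) _ _ balanced ⟩
      sumV (λ v → signSum v ℤ.* χ (q β v))      ≡⟨ signSum-correlation β ⟩
      sumL (λ φ → correlation φ β) L            ≡⟨ ∉Δ⇒correlation≡0 β β∉Δ ⟩
      0ℤ                                        ∎)) (∈Δ⇒correlation>0 α α∈Δ)
      where
      open CrossPair cross
      open ≡-Reasoning

      FS : QForm n ε → V n → ℤ
      FS γ v = signSum v ℤ.* χ (q γ v)

      sum-FS : ∀ γ δ → sumV (λ v → FS γ v ℤ.+ c ℤ.* χ (q δ v)) ≡ sumV (FS γ) ℤ.+ c ℤ.* sumV (χ ∘ q δ)
      sum-FS γ δ = trans (sumV-+ (FS γ) (λ v → c ℤ.* χ (q δ v))) (cong (ℤ._+_ (sumV (FS γ))) (sumV-*ˡ c (χ ∘ q δ)))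

      -- At v = 0 both forms vanish, elsewhere the sign sum is c.
      pointwise : ∀ v → FS α v ℤ.+ c ℤ.* χ (q β v) ≡ FS β v ℤ.+ c ℤ.* χ (q α v)
      pointwise v with ≡-dec Bool._≟_ v 𝟎
      ... | yes refl rewrite q-𝟎 α | q-𝟎 β = refl
      ... | no  v≢𝟎 rewrite F≡c v v≢𝟎 = ℤ.+-comm (c ℤ.* χ (q α v)) (c ℤ.* χ (q β v))

      balanced : sumV (FS α) ℤ.+ c ℤ.* sumV (χ ∘ q α) ≡ sumV (FS β) ℤ.+ c ℤ.* sumV (χ ∘ q α)
      balanced = begin
        sumV (FS α) ℤ.+ c ℤ.* sumV (χ ∘ q α)            ≡⟨ cong (λ s → sumV (FS α) ℤ.+ c ℤ.* s) charSum-α≡β ⟩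
        sumV (FS α) ℤ.+ c ℤ.* sumV (χ ∘ q β)            ≡⟨ sum-FS α β ⟨
        sumV (λ v → FS α v ℤ.+ c ℤ.* χ (q β v))         ≡⟨ sumV-cong pointwise ⟩
        sumV (λ v → FS β v ℤ.+ c ℤ.* χ (q α v))         ≡⟨ sum-FS β α ⟩
        sumV (FS β) ℤ.+ c ℤ.* sumV (χ ∘ q α)            ∎

    -- Transitivity of the stabiliser on cross pairs

    module _ (transitive : ∀ (α α′ β β′ : QForm n ε) → mem Δ α ≡ true → mem Δ α′ ≡ true →
                           mem Δ β ≡ false → mem Δ β′ ≡ false →
                           Σ (Sp n) λ g → Stab Δ g × Img g α α′ × Img g β β′) where

      -- Some `g` in the stabiliser carries the pair for `u` to the pair for `v`. The difference of
      -- a pair is the linear form pairing with its centre, so nondegeneracy of `B` shows that `g`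
      -- carries `u` to `v`.
      CrossPair⇒signSum≡ : ∀ {u v} → CrossPair Δ u → CrossPair Δ v → signSum u ≡ signSum v
      CrossPair⇒signSum≡ {u} {v} cu cv with transitive _ _ _ _ U.α∈Δ W.α∈Δ U.β∉Δ W.β∉Δ
        where module U = CrossPair cu
              module W = CrossPair cv
      ... | g , g∈G , gα , gβ = trans (signSum-stab g g∈G u) (cong signSum gu≡v)
        where
        open ≡-Reasoning
        module U = CrossPair cu
        module W = CrossPair cv
        gu≡v : f g u ≡ v
        gu≡v = B-injectiveʳ n (f g u) v λ x → xor-cancelˡ (q W.α x) (begin
          q W.α x xor B n x (f g u)                        ≡⟨ cong₂ (λ a y → a xor B n y (f g u)) (gα x) (sym (rinv g x)) ⟩
          q U.α (finv g x) xor B n (f g (finv g x)) (f g u) ≡⟨ cong (q U.α (finv g x) xor_) (presB g (finv g x) u) ⟩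
          q U.α (finv g x) xor B n (finv g x) u            ≡⟨ U.β≈α+v (finv g x) ⟨
          q U.β (finv g x)                                 ≡⟨ gβ x ⟨
          q W.β x                                          ≡⟨ W.β≈α+v x ⟩
          q W.α x xor B n x v                              ∎)

      -- Being a CrossPair centre is only known up to double negation, which suffices for ⊥
      -- and for equalities of integers.
      stabiliser-contains-transvection : ∀ u → u ≢ 𝟎 → ¬ (∀ v → v ≢ 𝟎 → ¬ Stab Δ (transvection n v))
      stabiliser-contains-transvection u u≢𝟎 no-transvection = ¬¬CrossPair u u≢𝟎 λ cu →
        signSum-constant⇒⊥ cu (signSum u) λ v v≢𝟎 →
          decidable-stable (signSum v ℤ.≟ signSum u) λ F≢ →
            ¬¬CrossPair v v≢𝟎 λ cv → F≢ (CrossPair⇒signSum≡ cv cu)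
        where
        ¬¬CrossPair : ∀ v → v ≢ 𝟎 → ¬ ¬ CrossPair Δ v
        -- Without a cross pair centred at `v`, no form changes membership under the transvection,
        -- which therefore stabilises `Δ`.
        ¬¬CrossPair v v≢𝟎 ¬cross = no-transvection v v≢𝟎 λ φ ψ img →
          decidable-stable (mem Δ φ Bool.≟ mem Δ ψ) λ φ≢ψ → ¬cross (moved⇒CrossPair Δ v φ ψ img φ≢ψ)

theorem6p12 : ∀ (n : ℕ) → 2 ≤ n →
    ∀ (ε : Sign) (k : ℕ) → 2 ≤ k → k + 2 ≤ sizeQ n ε →
    ∀ (Γ : Code n ε) → StronglyIncTrans Γ k →
    ∀ (Δ : Subset n ε) → Γ Δ → Irreducible (Stab Δ) →
    ∀ (b : ℕ) (F : FiniteField b) (S : C3Data n b F) →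
    ¬ (∀ g → Stab Δ g → InC3 S g)
theorem6p12 (suc n) _ ε k _ _ Γ (_ , size , _ , _ , transitive) Δ Δ∈Γ _ b F S G≤C₃ =
  -- Any nonzero vector can fix the reference value of the sign sum; `true ∷ 𝟎` is available once
  -- `n` is a successor.
  stabiliser-contains-transvection Δ (size Δ Δ∈Γ) (transitive Δ Δ∈Γ) (true ∷ 𝟎) (λ ())
    λ v v≢𝟎 t∈G → transvection∉C₃ S v v≢𝟎 (G≤C₃ (transvection (suc n) v) t∈G)
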